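{- For every odd integer $k\ge 3$, the set of claws formed by the edges $M=\{v_iu_i^1,v_iu_i^2,v_iu_i^3 : 1\le i\le k\}$ is a planarizing perfect pseudo-matching of the flower snark $J_k$.
   Context: A perfect pseudo-matching $M$ in a graph $G$ is a collection of vertex-disjoint subgraphs of $G$, each isomorphic to $K_2$ or $K_{1,3}$, whose vertex sets together cover $V(G)$. $G/M$ is the (multi)graph obtained by contracting each member of $M$ to a single vertex. $M$ is planarizing if $G/M$ is planar. For an odd integer $k\ge 3$, the flower snark $J_k$ has vertex set $\{v_1,\dots,v_k\}\cup\{u_i^1,u_i^2,u_i^3 : 1\le i\le k\}$. Its edges are those of the cycle $u_1^1u_2^1\cdots u_k^1u_1^1$ of length $k$, those of the cycle $u_1^2u_2^2\cdots u_k^2u_1^3u_2^3\cdots u_k^3u_1^2$ of length $2k$, and the edges $v_iu_i^1,v_iu_i^2,v_iu_i^3$ for $1\le i\le k$. -}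

module Defs where

open import Data.Fin.Base using (Fin; zero; suc; toℕ; inject₁; splitAt)
open import Data.Irrelevant as Irrelevant using ()
open import Data.Nat.Base as ℕ using (ℕ; zero; suc)
open import Data.Nat.DivMod using (_mod_)
open import Data.Product.Base using (Σ; Σ-syntax; ∃-syntax; _×_; _,_; proj₁; proj₂)
import Data.Product.Base as Product
open import Data.Rational.Base using (ℚ; 0ℚ; 1ℚ; _+_; _*_; _-_; _≤_; _<_)
open import Data.Refinement.Base using (Refinement-syntax; _,_)
open import Data.Sum.Base using (_⊎_; inj₁; inj₂; [_,_]′)
open import Data.Vec.Base using (Vec; _∷_; _∷ʳ_; lookup)
open import Function.Bundles using (_↔_; Inverse)
open import Relation.Binary.PropositionalEquality.Core using (_≡_; _≢_; refl)
open import Relation.Nullary.Negation.Core using (¬_)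

-- Undirected multigraphs, loops allowed. The order of the two ends of an edge
-- is an arbitrary choice without meaning; see SameEnds.

record Graph : Set₁ where
  field
    V    : Set
    E    : Set
    ends : E → V × V

  source target : E → V
  source e = proj₁ (ends e)
  target e = proj₂ (ends e)

open Graph public

SameEnds : {A : Set} → A × A → A × A → Set
SameEnds (a , b) (c , d) = (a ≡ c × b ≡ d) ⊎ (a ≡ d × b ≡ c)

record _≅_ (G H : Graph) : Set where
  field
    onV       : V G ↔ V H
    onE       : E G ↔ E H
    preserves : ∀ e → SameEnds (ends H (Inverse.to onE e))
                               (Product.map (Inverse.to onV) (Inverse.to onV) (ends G e))

K₂ : Graph
K₂ = record { V = Fin 2 ; E = Fin 1 ; ends = λ _ → zero , suc zero }

K₍_,_₎ : ℕ → ℕ → Graph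
K₍ m , n ₎ = record
  { V    = Fin m ⊎ Fin n
  ; E    = Fin m × Fin n
  ; ends = λ (a , b) → inj₁ a , inj₂ b
  }

record Subgraph (G : Graph) : Set₁ where
  field
    hasV   : V G → Set
    hasE   : E G → Set
    closed : ∀ {e} → hasE e → hasV (source G e) × hasV (target G e)

open Subgraph public

-- Membership proofs are irrelevant (Refinement), so that a vertex or an edge
-- of the subgraph is counted once however many proofs its membership has.
asGraph : {G : Graph} → Subgraph G → Graph
asGraph {G} H = record
  { V    = [ x ∈ V G ∣ hasV H x ]
  ; E    = [ e ∈ E G ∣ hasE H e ]
  ; ends = λ (e , p) → (source G e , Irrelevant.map (λ q → proj₁ (closed H q)) p)
                     , (target G e , Irrelevant.map (λ q → proj₂ (closed H q)) p)
  }

-- A collection of subgraphs is given as a family M indexed by a type I. Members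
-- of a pseudo-matching are nonempty, so disjointness makes them distinct.
record IsPerfectPseudoMatching (G : Graph) {I : Set} (M : I → Subgraph G) : Set where
  field
    shape    : ∀ i → (asGraph (M i) ≅ K₂) ⊎ (asGraph (M i) ≅ K₍ 1 , 3 ₎)
    disjoint : ∀ {i j} → i ≢ j → ∀ x → ¬ (hasV (M i) x × hasV (M j) x)
    covers   : ∀ x → ∃[ i ] hasV (M i) x

-- G/M. Its vertices are the members of M; its edges are the edges of G lying in
-- no member, each joining the members that contain its ends. Parallel edges are
-- kept, and an edge outside M with both ends in one member becomes a loop.
contract : (G : Graph) {I : Set} (M : I → Subgraph G) →
           IsPerfectPseudoMatching G M → Graph
contract G {I} M ppm = record
  { V    = I
  ; E    = [ e ∈ E G ∣ (∀ i → ¬ hasE (M i) e) ]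
  ; ends = λ (e , _) → member (source G e) , member (target G e)
  }
  where
  member : V G → I
  member x = proj₁ (IsPerfectPseudoMatching.covers ppm x)

-- Plane drawings of finite graphs: vertices are distinct points, edges are
-- simple polygonal arcs (closed curves, for loops) joining their ends, and an
-- edge meets the vertices and the other edges only at its ends. Corners are
-- rational: every finite plane graph can be redrawn with polygonal arcs, whose
-- corners can then be moved to rational points. Two rational segments sharing a
-- point of ℝ² that is interior to one of them also share such a point of ℚ²,
-- hence comparing only their rational points is enough.

Point : Set
Point = ℚ × ℚ

between : Point → Point → ℚ → Point
between (x , y) (x′ , y′) t = (1ℚ - t) * x + t * x′ , (1ℚ - t) * y + t * y′

-- Parameters of the points, other than the two ends, of a polygonal arc
-- consisting of n segments. Each segment is half-open, 0 ≤ t < 1, so that a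
-- corner is only counted on the segment that it starts.
record Inner (n : ℕ) : Set where
  field
    seg      : Fin n
    t        : ℚ
    0≤t      : 0ℚ ≤ t
    t<1      : t < 1ℚ
    notStart : ¬ (toℕ seg ≡ 0 × t ≡ 0ℚ)

open Inner public using (seg; t)

record PlaneDrawing (G : Graph) : Set where
  field
    pos   : V G → Point
    #bend : E G → ℕ
    bend  : (e : E G) → Vec Point (#bend e)

  corners : (e : E G) → Vec Point (suc (suc (#bend e)))
  corners e = pos (source G e) ∷ (bend e ∷ʳ pos (target G e))

  InnerOf : E G → Set
  InnerOf e = Inner (suc (#bend e))

  point : (e : E G) → InnerOf e → Point
  point e s = between (lookup (corners e) (inject₁ (seg s)))
                      (lookup (corners e) (suc (seg s)))
                      (t s)

  field
    distinct    : ∀ {x y} → pos x ≡ pos y → x ≡ y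
    simple      : ∀ e (s s′ : InnerOf e) → point e s ≡ point e s′ →
                  seg s ≡ seg s′ × t s ≡ t s′
    avoids      : ∀ e (s : InnerOf e) x → point e s ≢ pos x
    nonCrossing : ∀ {e e′} → e ≢ e′ → (s : InnerOf e) (s′ : InnerOf e′) →
                  point e s ≢ point e′ s′

Planar : Graph → Set
Planar = PlaneDrawing

IsPlanarizingPerfectPseudoMatching : (G : Graph) {I : Set} (M : I → Subgraph G) → Set
IsPlanarizingPerfectPseudoMatching G M =
  Σ[ ppm ∈ IsPerfectPseudoMatching G M ] Planar (contract G M ppm)

-- Flower snarks. Indices are shifted: i ranges over 0, …, k - 1 and the
-- superscript j over 0, 1, 2.

next : ∀ {n} → Fin n → Fin n
next {suc n} i = suc (toℕ i) mod suc n

data FlowerV (k : ℕ) : Set where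
  v : Fin k → FlowerV k
  u : Fin 3 → Fin k → FlowerV k

-- The vertices of the cycle of length 2k, in cyclic order.
long : ∀ {k} → Fin (k ℕ.+ k) → FlowerV k
long {k} p = [ u (suc zero) , u (suc (suc zero)) ]′ (splitAt k p)

data FlowerE (k : ℕ) : Set where
  shortCycle : Fin k → FlowerE k
  longCycle  : Fin (k ℕ.+ k) → FlowerE k
  spoke      : Fin k → Fin 3 → FlowerE k

J : ℕ → Graph
J k = record { V = FlowerV k ; E = FlowerE k ; ends = flowerEnds }
  where
  flowerEnds : FlowerE k → FlowerV k × FlowerV k
  flowerEnds (shortCycle i) = u zero i , u zero (next i)
  flowerEnds (longCycle p)  = long p , long (next p)
  flowerEnds (spoke i j)    = v i , u j i

claw : ∀ k → Fin k → Subgraph (J k)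
claw k i = record
  { hasV   = λ x → x ≡ v i ⊎ (∃[ j ] x ≡ u j i)
  ; hasE   = λ e → ∃[ j ] e ≡ spoke i j
  ; closed = λ { (j , refl) → inj₁ refl , inj₂ (j , refl) }
  }

{-# OPTIONS --safe #-}
-- Contracting the claws of J k leaves a cycle of length k with every edge
-- tripled. Put its i-th vertex at (2i , 0) and draw an edge from the p-th to the
-- q-th vertex as a tent with apex (p + q , l (q - p)²), where the three parallel
-- edges get different levels l ∈ [1 , 2). Parallel edges differ in height, the
-- edges p → p + 1 lie over disjoint intervals and have slopes less than 2 in
-- absolute value, and the edges k - 1 → 0 pass above all of these since their
-- slopes are at least k - 1 ≥ 2 in absolute value.
module Submission where

open import Defs
open import Data.Empty using (⊥-elim)
open import Data.Empty.Irrelevant renaming (⊥-elim to ⊥-elim-irr)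
open import Data.Fin.Base using (Fin; zero; suc; toℕ; inject₁; splitAt; _↑ˡ_; _↑ʳ_)
open import Data.Fin.Properties
  using (_≟_; all?; toℕ-injective; toℕ<n; toℕ-fromℕ<; toℕ-↑ˡ; toℕ-↑ʳ; splitAt⁻¹-↑ˡ; splitAt⁻¹-↑ʳ)
open import Data.Integer.Base using (+_)
open import Data.Irrelevant using ([_])
open import Data.Nat.Base as ℕ using (ℕ; zero; suc; _≤_; z≤n; s≤s)
open import Data.Nat.Divisibility using (_∣_; ∣-refl; ∣m∣n⇒∣m+n)
open import Data.Nat.DivMod
  using (_%_; m<n⇒m%n≡m; n%n≡0; [m+n]%n≡m%n; m%n%n≡m%n; m∣n⇒o%n%m≡o%m; %-distribˡ-+)
import Data.Nat.Properties as ℕ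
open import Data.Product.Base as Product using (_×_; _,_; proj₁; proj₂)
open import Data.Rational.Base as ℚ
  using (ℚ; 0ℚ; 1ℚ; _+_; _*_; _-_; -_; _<_; 1/_; _/_; positive; negative; nonNegative; ≢-nonZero)
open import Data.Rational.Properties hiding (_≟_)
open import Data.Rational.Solver using (module +-*-Solver)
open import Data.Refinement.Base using (_,_; value)
open import Data.Refinement.Properties using (value-injective)
open import Data.Sum.Base using (_⊎_; inj₁; inj₂)
open import Data.Vec.Base using ([]; _∷_; lookup)
open import Function.Base using (_∘_)
open import Function.Bundles using (mk↔ₛ′)
open import Relation.Binary.Definitions using (tri<; tri≈; tri>)
open import Relation.Binary.PropositionalEquality hiding (J; [_])
open import Relation.Nullary.Decidable.Core using (Dec; yes; no; from-yes; recompute; map′)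
open import Relation.Nullary.Negation.Core using (¬_)

open Inner using (0≤t; t<1; notStart)
open import Algebra.Properties.Group +-0-group using (x∙y⁻¹≈ε⇒x≈y) renaming (∙-cancelˡ to +-cancelˡ)
open +-*-Solver using (solve; _:=_; _:+_; _:*_; _:-_; con)

-- Rational arithmetic

2ℚ : ℚ
2ℚ = 1ℚ + 1ℚ

*-cancelʳ-nonZero : ∀ r {p q} → r ≢ 0ℚ → p * r ≡ q * r → p ≡ q
*-cancelʳ-nonZero r {p} {q} r≢0 eq = begin
  p                ≡⟨ cancel p ⟨
  p * r * (1/ r)   ≡⟨ cong (_* (1/ r)) eq ⟩
  q * r * (1/ r)   ≡⟨ cancel q ⟩
  q                ∎
  where
  open ≡-Reasoning
  instance _ = ≢-nonZero r≢0
  cancel : ∀ p → p * r * (1/ r) ≡ p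
  cancel p = trans (*-assoc p r (1/ r)) (trans (cong (p *_) (*-inverseʳ r)) (*-identityʳ p))

*-positive : ∀ {p q} → 0ℚ < p → 0ℚ < q → 0ℚ < p * q
*-positive {p} {q} 0<p 0<q =
  subst (_< p * q) (*-zeroʳ p) (*-monoʳ-<-pos p {{positive 0<p}} 0<q)

square-positive : ∀ {p} → p ≢ 0ℚ → 0ℚ < p * p
square-positive {p} p≢0 with <-cmp p 0ℚ
... | tri≈ _ p≡0 _ = ⊥-elim (p≢0 p≡0)
... | tri> _ _ p>0 = *-positive p>0 p>0
... | tri< p<0 _ _ = subst (_< p * p) (*-zeroʳ p) (*-monoʳ-<-neg p {{negative p<0}} p<0)

-- Tents

-- run measures the way along the two segments by a number in (0 , 2), and tent is
-- min (run , 2 - run).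
run tent : Inner 2 → ℚ
run s with seg s
... | zero     = t s
... | suc zero = 1ℚ + t s
tent s with seg s
... | zero     = t s
... | suc zero = 1ℚ - t s

-- One closed form for both segments of the tent, so that a coincidence of points becomes two
-- equations in `run` and `tent`.
arc : ℚ → ℚ → ℚ → Inner 2 → Point
arc p q l s = (p + p) + run s * (q - p) , tent s * (l * ((q - p) * (q - p)))

apex : ℚ → ℚ → ℚ → Point
apex p q l = p + q , l * ((q - p) * (q - p))

arc-between : ∀ p q l s →
  let corners = (p + p , 0ℚ) ∷ apex p q l ∷ (q + q , 0ℚ) ∷ [] in
  between (lookup corners (inject₁ (seg s))) (lookup corners (suc (seg s))) (t s) ≡ arc p q l s
arc-between p q l s with seg s
... | zero     = cong₂ _,_
  (solve 3 (λ p q t → (con 1ℚ :- t) :* (p :+ p) :+ t :* (p :+ q) := (p :+ p) :+ t :* (q :- p)) refl p q (t s))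
  (solve 2 (λ h t → (con 1ℚ :- t) :* con 0ℚ :+ t :* h := t :* h) refl (l * ((q - p) * (q - p))) (t s))
... | suc zero = cong₂ _,_
  (solve 3 (λ p q t → (con 1ℚ :- t) :* (p :+ q) :+ t :* (q :+ q) := (p :+ p) :+ (con 1ℚ :+ t) :* (q :- p)) refl p q (t s))
  (solve 2 (λ h t → (con 1ℚ :- t) :* h :+ t :* con 0ℚ := (con 1ℚ :- t) :* h) refl (l * ((q - p) * (q - p))) (t s))

0<1 : 0ℚ < 1ℚ
0<1 = from-yes (0ℚ <? 1ℚ)

0<1-t : ∀ {n} (s : Inner n) → 0ℚ < 1ℚ - t s
0<1-t s = subst (_< 1ℚ - t s) (+-inverseʳ (t s)) (+-monoˡ-< (- t s) (t<1 s))

notStart⇒0<t : ∀ {n} (s : Inner n) → toℕ (seg s) ≡ 0 → 0ℚ < t s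
notStart⇒0<t s seg≡0 with <-cmp 0ℚ (t s)
... | tri< 0<t _ _ = 0<t
... | tri≈ _ 0≡t _ = ⊥-elim (notStart s (seg≡0 , sym 0≡t))
... | tri> _ _ t<0 = ⊥-elim (<-irrefl refl (<-≤-trans t<0 (0≤t s)))

0<run : ∀ s → 0ℚ < run s
0<run s with seg s in eq
... | zero     = notStart⇒0<t s (cong toℕ eq)
... | suc zero = <-≤-trans 0<1 (+-monoʳ-≤ 1ℚ (0≤t s))

-- The tent vanishes only at its two ends: `notStart` excludes the first and `t<1` the second.
0<tent : ∀ s → 0ℚ < tent s
0<tent s with seg s in eq
... | zero     = notStart⇒0<t s (cong toℕ eq)
... | suc zero = 0<1-t s

run<2 : ∀ s → run s < 2ℚ
run<2 s with seg s
... | zero     = <-trans (t<1 s) (from-yes (1ℚ <? 2ℚ))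
... | suc zero = +-monoʳ-< 1ℚ (t<1 s)

tent+run≤2 : ∀ s → tent s + run s ℚ.≤ 2ℚ
tent+run≤2 s with seg s
... | zero     = +-mono-≤ (<⇒≤ (t<1 s)) (<⇒≤ (t<1 s))
... | suc zero = ≤-reflexive (solve 1 (λ t → (con 1ℚ :- t) :+ (con 1ℚ :+ t) := con 2ℚ) refl (t s))

tent≤run : ∀ s → tent s ℚ.≤ run s
tent≤run s with seg s
... | zero     = ≤-refl
... | suc zero = +-monoʳ-≤ 1ℚ (≤-trans (neg-antimono-≤ (0≤t s)) (0≤t s))

tent-sides : ∀ s → tent s ≡ run s ⊎ tent s ≡ 2ℚ - run s
tent-sides s with seg s
... | zero     = inj₁ refl
... | suc zero = inj₂ (solve 1 (λ t → con 1ℚ :- t := con 2ℚ :- (con 1ℚ :+ t)) refl (t s))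

-- Segments are half-open, so `run` is below 1 on the first one and at least 1 on the second.
run-injective : ∀ s s′ → run s ≡ run s′ → seg s ≡ seg s′ × t s ≡ t s′
run-injective s s′ eq with seg s | seg s′
... | zero     | zero     = refl , eq
... | suc zero | suc zero = refl , +-cancelˡ 1ℚ _ _ eq
... | zero     | suc zero =
  ⊥-elim (<-irrefl eq (<-≤-trans (t<1 s) (+-monoʳ-≤ 1ℚ (0≤t s′))))
... | suc zero | zero     =
  ⊥-elim (<-irrefl (sym eq) (<-≤-trans (t<1 s′) (+-monoʳ-≤ 1ℚ (0≤t s))))

run≡⇒tent≡ : ∀ s s′ → run s ≡ run s′ → tent s ≡ tent s′
run≡⇒tent≡ s s′ eq with run-injective s s′ eq
... | seg≡ , t≡ with seg s | seg s′ | seg≡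
...   | zero     | zero     | refl = t≡
...   | suc zero | suc zero | refl = cong (λ x → 1ℚ - x) t≡

p≢q⇒q-p≢0 : ∀ {p q} → p ≢ q → q - p ≢ 0ℚ
p≢q⇒q-p≢0 {p} {q} p≢q q-p≡0 = p≢q (sym (x∙y⁻¹≈ε⇒x≈y q p q-p≡0))

-- The abscissa is affine in `run` with slope `q - p`, so it fixes `run` and with it `tent`.
-- Dividing the height by `tent` and `(q - p)²` leaves the level. With `l = l′` this shows that an
-- arc is simple, otherwise that parallel edges do not cross.
arc-injective : ∀ p q l l′ → p ≢ q → ∀ s s′ → arc p q l s ≡ arc p q l′ s′ → run s ≡ run s′ × l ≡ l′
arc-injective p q l l′ p≢q s s′ eq = run≡ , l≡
  where
  h≢0 = p≢q⇒q-p≢0 p≢q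
  run≡ : run s ≡ run s′
  run≡ = *-cancelʳ-nonZero (q - p) h≢0 (+-cancelˡ (p + p) _ _ (cong proj₁ eq))
  l≡ : l ≡ l′
  l≡ = *-cancelʳ-nonZero ((q - p) * (q - p)) (λ h²≡0 → <-irrefl (sym h²≡0) (square-positive h≢0))
    (*-cancelʳ-nonZero (tent s) (λ t≡0 → <-irrefl (sym t≡0) (0<tent s)) (begin
      l * h² * tent s     ≡⟨ *-comm (l * h²) (tent s) ⟩
      tent s * (l * h²)   ≡⟨ cong proj₂ eq ⟩
      tent s′ * (l′ * h²) ≡⟨ cong (_* (l′ * h²)) (run≡⇒tent≡ s s′ run≡) ⟨
      tent s * (l′ * h²)  ≡⟨ *-comm (tent s) (l′ * h²) ⟩
      l′ * h² * tent s    ∎))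
    where
    open ≡-Reasoning
    h² = (q - p) * (q - p)

arc-above-axis : ∀ {p q l} → p ≢ q → 0ℚ < l → ∀ s → 0ℚ < proj₂ (arc p q l s)
arc-above-axis {p} {q} {l} p≢q 0<l s =
  *-positive (0<tent s) (*-positive 0<l (square-positive (p≢q⇒q-p≢0 p≢q)))

-- The vertical line at abscissa `2(p + 1)` lies strictly to the right of the first open arc, and
-- the second one lies strictly to the right of that line.
unit-arcs-separated : ∀ p p′ l l′ → p + 1ℚ ℚ.≤ p′ → ∀ s s′ → arc p (p + 1ℚ) l s ≢ arc p′ (p′ + 1ℚ) l′ s′
unit-arcs-separated p p′ _ _ p+1≤p′ s s′ eq = <-irrefl (cong proj₁ eq) (begin-strict
  (p + p) + run s * ((p + 1ℚ) - p)       ≡⟨ unit p (run s) ⟩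
  (p + p) + run s                        <⟨ +-monoʳ-< (p + p) (run<2 s) ⟩
  (p + p) + 2ℚ                           ≡⟨ solve 1 (λ p → (p :+ p) :+ con 2ℚ := (p :+ con 1ℚ) :+ (p :+ con 1ℚ)) refl p ⟩
  (p + 1ℚ) + (p + 1ℚ)                    ≤⟨ +-mono-≤ p+1≤p′ p+1≤p′ ⟩
  p′ + p′                                ≡⟨ +-identityʳ (p′ + p′) ⟨
  (p′ + p′) + 0ℚ                         <⟨ +-monoʳ-< (p′ + p′) (0<run s′) ⟩
  (p′ + p′) + run s′                     ≡⟨ unit p′ (run s′) ⟨
  (p′ + p′) + run s′ * ((p′ + 1ℚ) - p′)  ∎)
  where
  open ≤-Reasoning
  unit : ∀ p r → (p + p) + r * ((p + 1ℚ) - p) ≡ (p + p) + r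
  unit = solve 2 (λ p r → (p :+ p) :+ r :* ((p :+ con 1ℚ) :- p) := (p :+ p) :+ r) refl

-- The slopes of a unit arc are ±l, of absolute value less than 2, and those of
-- the arc from n to 0 are ±l′ * n, of absolute value at least 2.
unit-arc-below-long-arc : ∀ {p n l l′} → 0ℚ ℚ.≤ p → p + 1ℚ ℚ.≤ n → 2ℚ ℚ.≤ n → l < 2ℚ → 1ℚ ℚ.≤ l′ →
  ∀ s s′ → arc p (p + 1ℚ) l s ≢ arc n 0ℚ l′ s′
unit-arc-below-long-arc {p} {n} {l} {l′} 0≤p p+1≤n 2≤n l<2 1≤l′ s s′ eq =
  <-irrefl (cong proj₂ eq) (begin-strict
    tent s * (l * (((p + 1ℚ) - p) * ((p + 1ℚ) - p)))
      ≡⟨ solve 3 (λ a l p → a :* (l :* (((p :+ con 1ℚ) :- p) :* ((p :+ con 1ℚ) :- p))) := a :* l) refl (tent s) l p ⟩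
    tent s * l
      <⟨ *-monoʳ-<-pos (tent s) {{positive (0<tent s)}} l<2 ⟩
    tent s * 2ℚ
      -- The height of the long arc contains `n²`: one factor turns `tent s′` into a horizontal
      -- distance, the other is bounded below by 2.
      ≤⟨ *-monoʳ-≤-nonNeg 2ℚ tent≤tent*n ⟩
    (tent s′ * n) * 2ℚ
      ≤⟨ *-monoˡ-≤-nonNeg (tent s′ * n) {{nonNegative 0≤tent*n}} 2≤n ⟩
    (tent s′ * n) * n
      ≡⟨ *-identityˡ _ ⟨
    1ℚ * ((tent s′ * n) * n)
      ≤⟨ *-monoʳ-≤-nonNeg ((tent s′ * n) * n) {{nonNegative (<⇒≤ (*-positive 0<tent*n 0<n))}} 1≤l′ ⟩
    l′ * ((tent s′ * n) * n)
      ≡⟨ solve 3 (λ a l n → l :* ((a :* n) :* n) := a :* (l :* ((con 0ℚ :- n) :* (con 0ℚ :- n)))) refl (tent s′) l′ n ⟩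
    tent s′ * (l′ * ((0ℚ - n) * (0ℚ - n)))  ∎)
  where
  open ≤-Reasoning
  0<n : 0ℚ < n
  0<n = <-≤-trans (from-yes (0ℚ <? 2ℚ)) 2≤n
  0<tent*n : 0ℚ < tent s′ * n
  0<tent*n = *-positive (0<tent s′) 0<n
  0≤tent*n : 0ℚ ℚ.≤ tent s′ * n
  0≤tent*n = <⇒≤ 0<tent*n
  abscissa : (p + p) + run s ≡ (n + n) - run s′ * n
  abscissa = begin-equality
    (p + p) + run s                   ≡⟨ solve 2 (λ p r → (p :+ p) :+ r := (p :+ p) :+ r :* ((p :+ con 1ℚ) :- p)) refl p (run s) ⟩
    (p + p) + run s * ((p + 1ℚ) - p)  ≡⟨ cong proj₁ eq ⟩
    (n + n) + run s′ * (0ℚ - n)       ≡⟨ solve 2 (λ n r → (n :+ n) :+ r :* (con 0ℚ :- n) := (n :+ n) :- r :* n) refl n (run s′) ⟩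
    (n + n) - run s′ * n              ∎
  -- The interval under the unit arc lies inside that under the long arc, so `tent s` is at most the
  -- horizontal distance to either end, 0 or `n + n`, of the long arc.
  left : tent s ℚ.≤ (p + p) + run s
  left = begin
    tent s             ≤⟨ tent≤run s ⟩
    run s              ≡⟨ +-identityˡ (run s) ⟨
    0ℚ + run s         ≤⟨ +-monoˡ-≤ (run s) (+-mono-≤ 0≤p 0≤p) ⟩
    (p + p) + run s    ∎
  right : tent s ℚ.≤ (n + n) - ((p + p) + run s)
  right = begin
    tent s                                        ≡⟨ solve 2 (λ a r → a := (a :+ r) :- r) refl (tent s) (run s) ⟩
    (tent s + run s) - run s                      ≤⟨ +-monoˡ-≤ (- run s) (tent+run≤2 s) ⟩
    2ℚ - run s                                    ≡⟨ solve 2 (λ p r → con 2ℚ :- r := ((p :+ con 1ℚ) :+ (p :+ con 1ℚ)) :- ((p :+ p) :+ r)) refl p (run s) ⟩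
    ((p + 1ℚ) + (p + 1ℚ)) - ((p + p) + run s)     ≤⟨ +-monoˡ-≤ (- ((p + p) + run s)) (+-mono-≤ p+1≤n p+1≤n) ⟩
    (n + n) - ((p + p) + run s)                   ∎
  tent≤tent*n : tent s ℚ.≤ tent s′ * n
  -- `tent s′ * n` is the horizontal distance to the end `n + n` on the first segment of the long
  -- arc and to the end 0 on the second.
  tent≤tent*n with tent-sides s′
  ... | inj₁ tent≡ = begin
    tent s                            ≤⟨ right ⟩
    (n + n) - ((p + p) + run s)       ≡⟨ cong (λ x → (n + n) - x) abscissa ⟩
    (n + n) - ((n + n) - run s′ * n)  ≡⟨ solve 2 (λ n a → n :- (n :- a) := a) refl (n + n) (run s′ * n) ⟩
    run s′ * n                        ≡⟨ cong (_* n) tent≡ ⟨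
    tent s′ * n                       ∎
  ... | inj₂ tent≡ = begin
    tent s                            ≤⟨ left ⟩
    (p + p) + run s                   ≡⟨ abscissa ⟩
    (n + n) - run s′ * n              ≡⟨ solve 2 (λ n r → (n :+ n) :- r :* n := (con 2ℚ :- r) :* n) refl n (run s′) ⟩
    (2ℚ - run s′) * n                 ≡⟨ cong (_* n) tent≡ ⟨
    tent s′ * n                       ∎

-- Natural numbers as rationals

ι : ℕ → ℚ
ι zero    = 0ℚ
-- Holding by computation, this makes an arc from `ι i` to `ι (suc i)` literally a unit arc.
ι (suc n) = ι n + 1ℚ

ι-step : ∀ n → ι n < ι n + 1ℚ
ι-step n = subst (_< ι n + 1ℚ) (+-identityʳ (ι n)) (+-monoʳ-< (ι n) 0<1)

0≤ι : ∀ n → 0ℚ ℚ.≤ ι n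
0≤ι zero    = ≤-refl
0≤ι (suc n) = ≤-trans (0≤ι n) (<⇒≤ (ι-step n))

ι-mono-≤ : ∀ {m n} → m ≤ n → ι m ℚ.≤ ι n
ι-mono-≤ {n = n} z≤n = 0≤ι n
ι-mono-≤ (s≤s m≤n)   = +-monoˡ-≤ 1ℚ (ι-mono-≤ m≤n)

ι-mono-< : ∀ {m n} → m ℕ.< n → ι m < ι n
ι-mono-< {m} m<n = <-≤-trans (ι-step m) (ι-mono-≤ m<n)

ι-injective : ∀ {m n} → ι m ≡ ι n → m ≡ n
ι-injective {m} {n} eq with ℕ.<-cmp m n
... | tri< m<n _ _ = ⊥-elim (<-irrefl eq (ι-mono-< m<n))
... | tri≈ _ m≡n _ = m≡n
... | tri> _ _ n<m = ⊥-elim (<-irrefl (sym eq) (ι-mono-< n<m))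

p+p≡q+q⇒p≡q : ∀ {p q} → p + p ≡ q + q → p ≡ q
p+p≡q+q⇒p≡q {p} {q} eq with <-cmp p q
... | tri< p<q _ _ = ⊥-elim (<-irrefl eq (+-mono-< p<q p<q))
... | tri≈ _ p≡q _ = p≡q
... | tri> _ _ q<p = ⊥-elim (<-irrefl (sym eq) (+-mono-< q<p q<p))

-- Cyclic multigraphs

-- The successor relation of the cycle on 0, ..., `n`, split into the steps drawn as unit arcs and
-- the one drawn as the long arc.
data Step (n : ℕ) : ℕ → ℕ → Set where
  ascend : ∀ {i} → suc i ≤ n → Step n i (suc i)
  wrap   : Step n n 0

Step⇒ι≢ι : ∀ {n i j} → 1 ≤ n → Step n i j → ι i ≢ ι j
Step⇒ι≢ι _ (ascend {i} _) eq = <-irrefl eq (ι-step i)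
Step⇒ι≢ι {n} 1≤n wrap eq with refl ← ι-injective {n} {0} eq = ℕ.n≮n 0 1≤n

-- Edges with a common source are therefore parallel.
Step-functional : ∀ {n i j k} → Step n i j → Step n i k → j ≡ k
Step-functional (ascend _)   (ascend _)   = refl
Step-functional (ascend n<n) wrap         = ⊥-elim (ℕ.n≮n _ n<n)
Step-functional wrap         (ascend n<n) = ⊥-elim (ℕ.n≮n _ n<n)
Step-functional wrap         wrap         = refl

-- Unit arcs with different sources are separated horizontally, a unit arc and a long arc are
-- separated by height, and all long arcs start at `n`.
arcs-meet⇒same-source : ∀ {n i j i′ j′} l l′ → 2 ≤ n → Step n i j → Step n i′ j′ →
  1ℚ ℚ.≤ l → l < 2ℚ → 1ℚ ℚ.≤ l′ → l′ < 2ℚ →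
  ∀ s s′ → arc (ι i) (ι j) l s ≡ arc (ι i′) (ι j′) l′ s′ → i ≡ i′
arcs-meet⇒same-source l l′ _ (ascend {i} _) (ascend {i′} _) _ _ _ _ s s′ eq with ℕ.<-cmp i i′
... | tri< i<i′ _ _ = ⊥-elim (unit-arcs-separated (ι i) (ι i′) l l′ (ι-mono-≤ i<i′) s s′ eq)
... | tri≈ _ i≡i′ _ = i≡i′
... | tri> _ _ i′<i = ⊥-elim (unit-arcs-separated (ι i′) (ι i) l′ l (ι-mono-≤ i′<i) s′ s (sym eq))
arcs-meet⇒same-source l l′ 2≤n (ascend {i} i<n) wrap _ l<2 1≤l′ _ s s′ eq =
  ⊥-elim (unit-arc-below-long-arc (0≤ι i) (ι-mono-≤ i<n) (ι-mono-≤ 2≤n) l<2 1≤l′ s s′ eq)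
arcs-meet⇒same-source l l′ 2≤n wrap (ascend {i} i<n) 1≤l _ _ l′<2 s s′ eq =
  ⊥-elim (unit-arc-below-long-arc (0≤ι i) (ι-mono-≤ i<n) (ι-mono-≤ 2≤n) l′<2 1≤l s′ s (sym eq))
arcs-meet⇒same-source _ _ _ wrap wrap _ _ _ _ _ _ _ = refl

-- By `steps`, edges with the same source are parallel, so `determined` asks that distinct parallel
-- edges have distinct levels.
module _ {n : ℕ} {E : Set} (ends : E → Fin (suc n) × Fin (suc n)) (level : E → ℚ) (2≤n : 2 ≤ n)
  (steps : ∀ e → Step n (toℕ (proj₁ (ends e))) (toℕ (proj₂ (ends e))))
  (1≤level : ∀ e → 1ℚ ℚ.≤ level e) (level<2 : ∀ e → level e < 2ℚ)
  (determined : ∀ {e e′} → proj₁ (ends e) ≡ proj₁ (ends e′) → level e ≡ level e′ → e ≡ e′)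
  where

  private
    from to : E → ℚ
    from e = ι (toℕ (proj₁ (ends e)))
    to   e = ι (toℕ (proj₂ (ends e)))

    arcOf : E → Inner 2 → Point
    arcOf e = arc (from e) (to e) (level e)

    from≢to : ∀ e → from e ≢ to e
    from≢to e = Step⇒ι≢ι (ℕ.≤-trans (ℕ.n≤1+n 1) 2≤n) (steps e)

    -- The inferred left side is what `point e s` unfolds to in the drawing below.
    arc-between′ : ∀ e s → _ ≡ arcOf e s
    arc-between′ e s = arc-between (from e) (to e) (level e) s

    -- A common point forces equal sources, hence equal targets; both arcs then have the same ends,
    -- and `arc-injective` yields equal levels.
    arcs-disjoint : ∀ {e e′} → e ≢ e′ → ∀ s s′ → arcOf e s ≢ arcOf e′ s′
    arcs-disjoint {e} {e′} e≢e′ s s′ eq = e≢e′ (determined (toℕ-injective toℕ-src≡)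
      (proj₂ (arc-injective (from e) (to e) (level e) (level e′) (from≢to e) s s′
        (trans eq (cong₂ (λ i j → arc (ι i) (ι j) (level e′) s′) (sym toℕ-src≡) (sym toℕ-tgt≡))))))
      where
      toℕ-src≡ : toℕ (proj₁ (ends e)) ≡ toℕ (proj₁ (ends e′))
      toℕ-src≡ = arcs-meet⇒same-source (level e) (level e′) 2≤n (steps e) (steps e′)
        (1≤level e) (level<2 e) (1≤level e′) (level<2 e′) s s′ eq
      toℕ-tgt≡ : toℕ (proj₂ (ends e)) ≡ toℕ (proj₂ (ends e′))
      toℕ-tgt≡ = Step-functional (steps e) (subst (λ i → Step n i _) (sym toℕ-src≡) (steps e′))

  cyclic⇒planar : Planar (record { V = Fin (suc n) ; E = E ; ends = ends })
  cyclic⇒planar = record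
    { pos         = λ x → ι (toℕ x) + ι (toℕ x) , 0ℚ
    ; #bend       = λ _ → 1
    ; bend        = λ e → apex (from e) (to e) (level e) ∷ []
    ; distinct    = toℕ-injective ∘ ι-injective ∘ p+p≡q+q⇒p≡q ∘ cong proj₁
    ; simple      = λ e s s′ eq → run-injective s s′
        (proj₁ (arc-injective (from e) (to e) (level e) (level e) (from≢to e) s s′ (onArcs e s e s′ eq)))
    ; avoids      = λ e s x eq → <-irrefl
        (sym (cong proj₂ (trans (sym (arc-between′ e s)) eq)))
        (arc-above-axis (from≢to e) (<-≤-trans 0<1 (1≤level e)) s)
    ; nonCrossing = λ {e} {e′} e≢e′ s s′ → arcs-disjoint e≢e′ s s′ ∘ onArcs e s e′ s′
    }
    where
    onArcs : ∀ e s e′ s′ → _ ≡ _ → arcOf e s ≡ arcOf e′ s′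
    onArcs e s e′ s′ eq = trans (sym (arc-between′ e s)) (trans eq (arc-between′ e′ s′))

-- Claws

-- Membership in `asGraph` is irrelevant; deciding it lets `recompute` recover the leaf of the
-- spoke.
spoke∈claw? : ∀ {k} (i : Fin k) e → Dec (hasE (claw k i) e)
spoke∈claw? i (shortCycle _) = no λ ()
spoke∈claw? i (longCycle _)  = no λ ()
spoke∈claw? i (spoke i′ j)   = map′ (λ { refl → j , refl }) (λ { (_ , refl) → refl }) (i′ ≟ i)

v∈claw : ∀ {k} {i i′ : Fin k} → hasV (claw k i) (v i′) → i′ ≡ i
v∈claw (inj₁ refl) = refl

u∈claw : ∀ {k j} {i i′ : Fin k} → hasV (claw k i) (u j i′) → i′ ≡ i
u∈claw (inj₂ (_ , refl)) = refl

claw≅K₁₃ : ∀ k i → asGraph (claw k i) ≅ K₍ 1 , 3 ₎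
claw≅K₁₃ k i = record
  { onV       = mk↔ₛ′ V→ V← V→V← V←V→
  ; onE       = mk↔ₛ′ E→ E← E→E← E←E→
  ; preserves = preserves
  }
  where
  V→ : V (asGraph (claw k i)) → Fin 1 ⊎ Fin 3
  V→ (v _   , _) = inj₁ zero
  V→ (u j _ , _) = inj₂ j
  V← : Fin 1 ⊎ Fin 3 → V (asGraph (claw k i))
  V← (inj₁ _) = v i   , [ inj₁ refl ]
  V← (inj₂ j) = u j i , [ inj₂ (j , refl) ]
  V→V← : ∀ x → V→ (V← x) ≡ x
  V→V← (inj₁ zero) = refl
  V→V← (inj₂ j)    = refl
  V←V→ : ∀ x → V← (V→ x) ≡ x
  V←V→ (v i′   , [ p ]) with refl ← recompute (i′ ≟ i) (v∈claw p) = refl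
  V←V→ (u j i′ , [ p ]) with refl ← recompute (i′ ≟ i) (u∈claw p) = refl

  E→ : E (asGraph (claw k i)) → Fin 1 × Fin 3
  E→ (e , [ p ]) = zero , proj₁ (recompute (spoke∈claw? i e) p)
  E← : Fin 1 × Fin 3 → E (asGraph (claw k i))
  E← (_ , j) = spoke i j , [ j , refl ]
  E→E← : ∀ e → E→ (E← e) ≡ e
  -- The decision is stuck on `i ≟ i`, so the recomputed leaf is identified with `j` through its own
  -- proof.
  E→E← (zero , j) with recompute (spoke∈claw? i (spoke i j)) (j , refl)
  ... | _ , refl = refl
  E←E→ : ∀ e → E← (E→ e) ≡ e
  E←E→ (e , [ p ]) with recompute (spoke∈claw? i e) p
  ... | _ , refl = refl
  preserves : ∀ e → SameEnds (ends K₍ 1 , 3 ₎ (E→ e))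
                             (Product.map V→ V→ (ends (asGraph (claw k i)) e))
  preserves (e , [ p ]) with recompute (spoke∈claw? i e) p
  ... | _ , refl = inj₁ (refl , refl)

claws-perfect : ∀ k → IsPerfectPseudoMatching (J k) (claw k)
claws-perfect k = record
  { shape    = λ i → inj₂ (claw≅K₁₃ k i)
  ; disjoint = λ where
      i≢j (v _)   (x∈i , x∈j) → i≢j (trans (sym (v∈claw x∈i)) (v∈claw x∈j))
      i≢j (u _ _) (x∈i , x∈j) → i≢j (trans (sym (u∈claw x∈i)) (u∈claw x∈j))
  ; covers   = λ where
      (v i)   → i , inj₁ refl
      (u j i) → i , inj₂ (j , refl)
  }

-- The contracted flower snark

suc-% : ∀ m n .{{_ : ℕ.NonZero n}} → suc m % n ≡ suc (m % n) % n
suc-% m n = begin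
  suc m % n                     ≡⟨ %-distribˡ-+ 1 m n ⟩
  (1 % n ℕ.+ m % n) % n         ≡⟨ cong (λ r → (1 % n ℕ.+ r) % n) (m%n%n≡m%n m n) ⟨
  (1 % n ℕ.+ m % n % n) % n     ≡⟨ %-distribˡ-+ 1 (m % n) n ⟨
  suc (m % n) % n               ∎
  where open ≡-Reasoning

toℕ-next : ∀ {n} (i : Fin (suc n)) → toℕ (next i) ≡ suc (toℕ i) % suc n
toℕ-next i = toℕ-fromℕ< _

next-step : ∀ {n} (i : Fin (suc n)) → Step n (toℕ i) (toℕ (next i))
next-step {n} i with ℕ.m≤n⇒m<n∨m≡n (toℕ<n i)
... | inj₁ 1+i<1+n = subst (Step n (toℕ i)) (sym (trans (toℕ-next i) (m<n⇒m%n≡m 1+i<1+n)))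
  (ascend (ℕ.s≤s⁻¹ 1+i<1+n))
... | inj₂ 1+i≡1+n = subst₂ (Step n) (sym (ℕ.suc-injective 1+i≡1+n))
  (sym (trans (toℕ-next i) (trans (cong (_% suc n) 1+i≡1+n) (n%n≡0 (suc n)))))
  wrap

-- A name for the local map `member` by which `contract` sends the ends of edges to claws.
column : ∀ {k} → FlowerV k → Fin k
column x = proj₁ (IsPerfectPseudoMatching.covers (claws-perfect _) x)

-- Positions `i` and `k + i` of the long cycle lie on different strands but in the same claw.
toℕ-column-long : ∀ {k} .{{_ : ℕ.NonZero k}} (p : Fin (k ℕ.+ k)) → toℕ (column (long {k} p)) ≡ toℕ p % k
toℕ-column-long {k} p with splitAt k p in eq
... | inj₁ i = begin
  toℕ i                                     ≡⟨ m<n⇒m%n≡m (toℕ<n i) ⟨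
  toℕ i % k                                 ≡⟨ cong (_% k) (toℕ-↑ˡ i k) ⟨
  toℕ (i ↑ˡ k) % k                          ≡⟨ cong (λ q → toℕ q % k) (splitAt⁻¹-↑ˡ {k} eq) ⟩
  toℕ p % k                                 ∎
  where open ≡-Reasoning
... | inj₂ i = begin
  toℕ i                                     ≡⟨ m<n⇒m%n≡m (toℕ<n i) ⟨
  toℕ i % k                                 ≡⟨ [m+n]%n≡m%n (toℕ i) k ⟨
  (toℕ i ℕ.+ k) % k                         ≡⟨ cong (_% k) (ℕ.+-comm (toℕ i) k) ⟩
  (k ℕ.+ toℕ i) % k                         ≡⟨ cong (_% k) (toℕ-↑ʳ k i) ⟨
  toℕ (k ↑ʳ i) % k                          ≡⟨ cong (λ q → toℕ q % k) (splitAt⁻¹-↑ʳ {k} eq) ⟩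
  toℕ p % k                                 ∎
  where open ≡-Reasoning

-- Since `k` divides `k + k`, reduction modulo `k` carries the successor modulo `k + k` to the
-- successor modulo `k`. The twist of the long cycle, where it changes strands, thus disappears in
-- the contraction.
column-long-next : ∀ {n} (p : Fin (suc n ℕ.+ suc n)) → column {suc n} (long (next p)) ≡ next (column (long p))
column-long-next {n} p = toℕ-injective (begin
  toℕ (column (long {k} (next p)))          ≡⟨ toℕ-column-long {k} (next p) ⟩
  toℕ (next p) % k                          ≡⟨ cong (_% k) (toℕ-next p) ⟩
  suc (toℕ p) % (k ℕ.+ k) % k               ≡⟨ m∣n⇒o%n%m≡o%m k (k ℕ.+ k) (suc (toℕ p)) (∣m∣n⇒∣m+n ∣-refl ∣-refl) ⟩
  suc (toℕ p) % k                           ≡⟨ suc-% (toℕ p) k ⟩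
  suc (toℕ p % k) % k                       ≡⟨ cong (λ m → suc m % k) (toℕ-column-long {k} p) ⟨
  suc (toℕ (column (long {k} p))) % k       ≡⟨ toℕ-next (column (long {k} p)) ⟨
  toℕ (next (column (long {k} p)))          ∎)
  where
  open ≡-Reasoning
  k = suc n

strandLevel : Fin 3 → ℚ
strandLevel zero             = 1ℚ
strandLevel (suc zero)       = + 5 / 4
strandLevel (suc (suc zero)) = + 3 / 2

strandLevel-injective : ∀ {j j′} → strandLevel j ≡ strandLevel j′ → j ≡ j′
strandLevel-injective {zero}           {zero}           _ = refl
strandLevel-injective {zero}           {suc zero}       ()
strandLevel-injective {zero}           {suc (suc zero)} ()
strandLevel-injective {suc zero}       {zero}           ()
strandLevel-injective {suc zero}       {suc zero}       _ = refl
strandLevel-injective {suc zero}       {suc (suc zero)} ()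
strandLevel-injective {suc (suc zero)} {zero}           ()
strandLevel-injective {suc (suc zero)} {suc zero}       ()
strandLevel-injective {suc (suc zero)} {suc (suc zero)} _ = refl

1≤strandLevel : ∀ j → 1ℚ ℚ.≤ strandLevel j
1≤strandLevel = from-yes (all? λ j → 1ℚ ≤? strandLevel j)

strandLevel<2 : ∀ j → strandLevel j < 2ℚ
strandLevel<2 = from-yes (all? λ j → strandLevel j <? 2ℚ)

-- The value at v is arbitrary: the edges starting there are spokes.
strand : ∀ {k} → FlowerV k → Fin 3
strand (v _)   = zero
strand (u j _) = j

-- The cycle edge with source `u j i` in the orientation chosen by `J`; this inverts the source map
-- away from the spokes.
cycleEdge : ∀ {k} → Fin 3 → Fin k → FlowerE k
cycleEdge     zero             i = shortCycle i
cycleEdge {k} (suc zero)       i = longCycle (i ↑ˡ k)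
cycleEdge {k} (suc (suc zero)) i = longCycle (k ↑ʳ i)

module _ (k : ℕ) where

  private
    Contracted : Graph
    Contracted = contract (J k) (claw k) (claws-perfect k)

  cycleEdge-strand-column : ∀ ((e , _) : E Contracted) →
    cycleEdge (strand (source (J k) e)) (column (source (J k) e)) ≡ e
  cycleEdge-strand-column (shortCycle i , _) = refl
  cycleEdge-strand-column (longCycle p  , _) with splitAt k p in eq
  ... | inj₁ i = cong longCycle (splitAt⁻¹-↑ˡ {k} eq)
  ... | inj₂ i = cong longCycle (splitAt⁻¹-↑ʳ {k} eq)
  cycleEdge-strand-column (spoke i j    , [ p ]) = ⊥-elim-irr (p i (j , refl))

  -- Supplies `determined`: the strand of the source in `J k` distinguishes the three edges leaving
  -- a contracted claw.
  source-determines : ∀ {e e′ : E Contracted} → source Contracted e ≡ source Contracted e′ →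
    strand (source (J k) (value e)) ≡ strand (source (J k) (value e′)) → e ≡ e′
  source-determines {e} {e′} column≡ strand≡ = value-injective (begin
    value e   ≡⟨ cycleEdge-strand-column e ⟨
    _         ≡⟨ cong₂ cycleEdge strand≡ column≡ ⟩
    _         ≡⟨ cycleEdge-strand-column e′ ⟩
    value e′  ∎)
    where open ≡-Reasoning

contracted-step : ∀ {n} (e : E (contract (J (suc n)) (claw (suc n)) (claws-perfect (suc n)))) →
  Step n (toℕ (column (source (J (suc n)) (value e)))) (toℕ (column (target (J (suc n)) (value e))))
contracted-step (shortCycle i , _) = next-step i
contracted-step (longCycle p  , _) =
  subst (λ i → Step _ (toℕ (column (long p))) (toℕ i)) (sym (column-long-next p)) (next-step (column (long p)))
contracted-step (spoke i j    , [ p ]) = ⊥-elim-irr (p i (j , refl))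

mainTheorem3 : ∀ (k : ℕ) → 3 ≤ k → ¬ (2 ∣ k) →
    IsPlanarizingPerfectPseudoMatching (J k) (claw k)
-- With `k = suc n` the last vertex is `n`, and `3 ≤ k` becomes the bound `2 ≤ n` behind the
-- steepness of the long arcs.
mainTheorem3 (suc n) (s≤s 2≤n) _ = claws-perfect (suc n) , cyclic⇒planar _
  (λ (e , _) → strandLevel (strand (source (J (suc n)) e))) 2≤n contracted-step
  (λ (e , _) → 1≤strandLevel (strand (source (J (suc n)) e)))
  (λ (e , _) → strandLevel<2 (strand (source (J (suc n)) e)))
  (λ column≡ level≡ → source-determines (suc n) column≡ (strandLevel-injective level≡))
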